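{- With $\gamma$ defined as below, $\frac{1}{3}\le \gamma\le \frac{2}{3}$.
   Context: For a graph $F$, $\mathrm{ex}_c(n,F)$ denotes the largest number of edges in a connected $n$-vertex graph containing no subgraph isomorphic to $F$. For a tree $T$ with $|T|$ vertices (where $|T|\ge 4$), let $\gamma_T:=\limsup_{n\to\infty}\frac{2}{|T|-2}\cdot\frac{\mathrm{ex}_c(n,T)}{n}$. Let $\mathcal{T}_k$ be the set of trees on at least $k$ vertices, $\gamma_k:=\inf\{\gamma_T: T\in\mathcal{T}_k\}$ (a monotone increasing sequence in $k$), and $\gamma:=\lim_{k\to\infty}\gamma_k$. -}

module Defs where

open import Data.Nat using (ℕ; zero; suc; _+_; _*_; _∸_; _≤_; _<_; _<ᵇ_)
open import Data.Bool using (Bool; true; false; _∧_; if_then_else_)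
open import Data.Fin using (Fin; toℕ)
open import Data.List using (List; map; allFin)
open import Data.Nat.ListAction using (sum)
open import Data.Product using (Σ; _×_; ∃; ∃-syntax)
open import Relation.Binary.PropositionalEquality using (_≡_)
open import Relation.Nullary using (¬_)
open import Function.Definitions using (Injective)

record Graph (n : ℕ) : Set where
  field
    adj    : Fin n → Fin n → Bool
    sym    : ∀ i j → adj i j ≡ adj j i
    irrefl : ∀ i → adj i i ≡ false
open Graph public

edges : {n : ℕ} → Graph n → ℕ
edges {n} G =
  sum (map (λ i → sum (map (λ j → if (toℕ i <ᵇ toℕ j) ∧ adj G i j then 1 else 0)
                           (allFin n)))
           (allFin n))

data Walk {n : ℕ} (G : Graph n) : Fin n → Fin n → Set where
  here : ∀ {u} → Walk G u u
  step : ∀ {u v w} → adj G u v ≡ true → Walk G v w → Walk G u w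

Connected : {n : ℕ} → Graph n → Set
Connected G = ∀ u v → Walk G u v

IsTree : {m : ℕ} → Graph m → Set
IsTree {m} T = Connected T × (edges T + 1 ≡ m)

Contains : {m n : ℕ} → Graph m → Graph n → Set
Contains {m} {n} T G =
  Σ (Fin m → Fin n) λ f → Injective _≡_ _≡_ f ×
    (∀ u v → adj T u v ≡ true → adj G (f u) (f v) ≡ true)

-- γ ≥ 1/3, unfolded: for every ε = 1/q there is k such that every tree T
-- with |T| = m ≥ max(k,4) has, for infinitely many n, a connected T-free
-- n-vertex graph G with 2 e(G) / ((m-2) n) > 1/3 - 1/q,
-- i.e. 6 q e(G) + 3 (m-2) n > q (m-2) n.
GammaLower : Set
GammaLower =
  ∀ (q : ℕ) → 1 ≤ q → ∃[ k ]
    (∀ (m : ℕ) → k ≤ m → 4 ≤ m → (T : Graph m) → IsTree T →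
      ∀ (N : ℕ) → ∃[ n ] (N ≤ n × Σ (Graph n) λ G →
        Connected G × ¬ Contains T G ×
        (q * (m ∸ 2) * n < 6 * q * edges G + 3 * (m ∸ 2) * n)))

-- γ ≤ 2/3, unfolded: for every k and ε = 1/q there is a tree T with
-- |T| = m ≥ max(k,4) and N such that for all n ≥ N every connected T-free
-- n-vertex graph G has 2 e(G) / ((m-2) n) ≤ 2/3 + 1/q,
-- i.e. 6 q e(G) ≤ (2q + 3) (m-2) n.
GammaUpper : Set
GammaUpper =
  ∀ (k q : ℕ) → 1 ≤ q → ∃[ m ] (k ≤ m × 4 ≤ m × Σ (Graph m) λ T → IsTree T ×
    ∃[ N ] (∀ (n : ℕ) → N ≤ n → (G : Graph n) → Connected G → ¬ Contains T G →
      6 * q * edges G ≤ (2 * q + 3) * (m ∸ 2) * n))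

{-# OPTIONS --safe #-}

-- Lower bound.  Put s slightly above (|T| − 2)/6.  If T has no vertex cover of size s, it is not contained in the
-- graph of s vertices joined to everything, which has about sn edges.  Otherwise every path of T has at most 2s + 1
-- vertices, so T cannot reach two cliques strung on a path at distance 2s + 2, and it has at most 2s + 1 vertices
-- outside one clique; hence cliques on |T| − 2 − 2s vertices are allowed.
--
-- Upper bound.  Let T be the broom made of a path with P edges and 2P leaves at its end.  A connected graph with more
-- than Pn edges has a subgraph of minimum degree at least P, so every vertex starts a path with P edges; if some degree
-- is at least 3P + 1 this gives T.  If all degrees are bounded and n is large, every vertex starts a geodesic of
-- length P, which meets its neighbourhood only once, so a vertex of degree 2P + 1 gives T.
module Submission where

open import Defs
open import Algebra.Properties.CommutativeMonoid.Sum as Summation using ()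
open import Data.Bool using (Bool; true; false; _∧_; _∨_; not; if_then_else_)
open import Data.Bool.Properties using (∨-comm; ¬-not; ∧-conicalˡ; ∧-conicalʳ) renaming (_≟_ to _≟ᵇ_)
open import Data.Fin using (Fin; zero; suc; toℕ; fromℕ<; inject₁; _↑ˡ_; _↑ʳ_; splitAt; join; combine; finToFun; funToFin)
open import Data.Fin.Properties using (toℕ-injective; toℕ<n; toℕ-fromℕ<; toℕ-inject₁; toℕ-↑ˡ; toℕ-↑ʳ;
  toℕ-combine; any?; all?; ¬∀⟶∃¬; injective⇒≤; splitAt-join; join-splitAt; finToFun-funToFin)
  renaming (_≟_ to _≟ᶠ_; suc-injective to suc-injectiveᶠ)
open import Data.List using (map; allFin; tabulate)
open import Data.List.Properties using (map-tabulate)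
open import Data.Nat
open import Data.Nat.DivMod
open import Data.Nat.Induction using (<-rec)
open import Data.Nat.ListAction renaming (sum to sumᴸ)
open import Data.Nat.Properties
open import Data.Nat.Tactic.RingSolver using (solve-∀)
open import Data.Product using (Σ; _×_; _,_; proj₁; proj₂; ∃; ∃-syntax; ∃₂)
open import Data.Sum as Sum using (_⊎_; inj₁; inj₂; [_,_]′)
open import Data.Sum.Properties using (inj₁-injective; inj₂-injective)
open import Data.Vec using (Vec; []; _∷_; lookup)
open import Function using (_∘_; id; case_of_)
open import Function.Definitions using (Injective)
open import Relation.Binary.Definitions using (tri<; tri≈; tri>)
open import Relation.Binary.PropositionalEquality as ≡ using (_≡_; _≢_; refl; cong; cong₂; subst; trans; module ≡-Reasoning)
open import Relation.Nullary using (¬_; Dec; yes; no; does; contradiction)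
open import Relation.Nullary.Decidable using (_×-dec_; _⊎-dec_; _→-dec_; ¬?; map′; dec-true; dec-false)

open Summation +-0-commutativeMonoid using (∑-distrib-+; ∑-comm; sum-cong-≗) renaming (sum to ∑)

private variable
  m n k d : ℕ

witness : ∀ {A : Set} (a? : Dec A) → does a? ≡ true → A
witness (yes a) _ = a

-- Finite sums and counting.

⟦_⟧ : Bool → ℕ
⟦ b ⟧ = if b then 1 else 0

⟦⟧≤1 : ∀ b → ⟦ b ⟧ ≤ 1
⟦⟧≤1 true  = ≤-refl
⟦⟧≤1 false = z≤n

∑-mono : {f g : Fin n → ℕ} → (∀ i → f i ≤ g i) → ∑ f ≤ ∑ g
∑-mono {zero}  h = z≤n
∑-mono {suc n} h = +-mono-≤ (h zero) (∑-mono (h ∘ suc))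

∑-const : ∀ n c → ∑ {n} (λ _ → c) ≡ n * c
∑-const zero    c = refl
∑-const (suc n) c = cong (c +_) (∑-const n c)

∑-zero : {f : Fin n → ℕ} → (∀ i → f i ≡ 0) → ∑ f ≡ 0
∑-zero {n} h = trans (sum-cong-≗ h) (trans (∑-const n 0) (*-zeroʳ n))

term≤∑ : (f : Fin n → ℕ) (i : Fin n) → f i ≤ ∑ f
term≤∑ f zero    = m≤m+n _ _
term≤∑ f (suc i) = ≤-trans (term≤∑ (f ∘ suc) i) (m≤n+m _ _)

∑-*ˡ : ∀ c (f : Fin n → ℕ) → ∑ (λ i → c * f i) ≡ c * ∑ f
∑-*ˡ {zero}  c f = ≡.sym (*-zeroʳ c)
∑-*ˡ {suc n} c f = trans (cong (c * f zero +_) (∑-*ˡ c (f ∘ suc))) (≡.sym (*-distribˡ-+ c _ _))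

∑-*ʳ : ∀ c (f : Fin n → ℕ) → ∑ (λ i → f i * c) ≡ ∑ f * c
∑-*ʳ c f = trans (sum-cong-≗ (λ i → *-comm (f i) c)) (trans (∑-*ˡ c f) (*-comm c _))

∑-δ : (f : Fin n → ℕ) (i : Fin n) → ∑ (λ j → ⟦ does (i ≟ᶠ j) ⟧ * f j) ≡ f i
∑-δ {suc n} f zero    = trans (cong₂ _+_ (+-identityʳ (f zero)) (∑-zero {n} {λ _ → 0} (λ _ → refl))) (+-identityʳ _)
∑-δ         f (suc i) = ∑-δ (f ∘ suc) i

∑-δ-1 : (i : Fin n) → ∑ (λ j → ⟦ does (i ≟ᶠ j) ⟧) ≡ 1
∑-δ-1 {n} i = trans (sum-cong-≗ {n} (λ j → ≡.sym (*-identityʳ _))) (∑-δ (λ _ → 1) i)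

∑-++ : ∀ m {n} (f : Fin (m + n) → ℕ) → ∑ f ≡ ∑ (λ i → f (i ↑ˡ n)) + ∑ (λ j → f (m ↑ʳ j))
∑-++ zero    f = refl
∑-++ (suc m) f = trans (cong (f zero +_) (∑-++ m (f ∘ suc))) (≡.sym (+-assoc (f zero) _ _))

∑-combine : ∀ m {n} (f : Fin (m * n) → ℕ) → ∑ f ≡ ∑ (λ i → ∑ (λ j → f (combine {m} {n} i j)))
∑-combine zero        f = refl
∑-combine (suc m) {n} f = trans (∑-++ n f) (cong (∑ (λ j → f (j ↑ˡ m * n)) +_) (∑-combine m (λ i → f (n ↑ʳ i))))

sum-allFin : (f : Fin n → ℕ) → sumᴸ (map f (allFin n)) ≡ ∑ f
sum-allFin f = trans (cong sumᴸ (map-tabulate id f)) (sum-tabulate f)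
  where
  sum-tabulate : (g : Fin k → ℕ) → sumᴸ (tabulate g) ≡ ∑ g
  sum-tabulate {zero}  g = refl
  sum-tabulate {suc k} g = cong (g zero +_) (sum-tabulate (g ∘ suc))

pick : (f : Fin n → Bool) → k ≤ ∑ (λ i → ⟦ f i ⟧) →
       Σ (Fin k → Fin n) λ ι → Injective _≡_ _≡_ ι × (∀ i → f (ι i) ≡ true)
pick {k = zero} f _ = (λ ()) , (λ {}) , λ ()
pick {suc n} {suc k} f h with f zero in eq
... | true  with ι , inj , ι-true ← pick (f ∘ suc) (≤-pred h) =
  (λ { zero → zero ; (suc i) → suc (ι i) }) ,
  (λ { {zero} {zero} _ → refl ; {suc i} {suc j} e → cong suc (inj (suc-injectiveᶠ e)) }) ,
  (λ { zero → eq ; (suc i) → ι-true i })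
... | false with ι , inj , ι-true ← pick (f ∘ suc) h =
  suc ∘ ι , inj ∘ suc-injectiveᶠ , ι-true

-- Double counting of the pairs with `p i ≡ z`: every `z` satisfying `f` has one with `g i` true,
-- and every `i` belongs to a single `z`. Repetitions in `p` do no harm.
count-cover : (f : Fin n → Bool) (g : Fin m → Bool) (p : Fin m → Fin n) →
  (∀ z → f z ≡ true → ∃ λ i → p i ≡ z × g i ≡ true) →
  ∑ (λ z → ⟦ f z ⟧) ≤ ∑ (λ i → ⟦ g i ⟧)
count-cover f g p cover = begin
  ∑ (λ z → ⟦ f z ⟧)                                        ≤⟨ ∑-mono bound ⟩
  ∑ (λ z → ∑ (λ i → ⟦ g i ⟧ * ⟦ does (p i ≟ᶠ z) ⟧))        ≡⟨ ∑-comm (λ z i → ⟦ g i ⟧ * ⟦ does (p i ≟ᶠ z) ⟧) ⟩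
  ∑ (λ i → ∑ (λ z → ⟦ g i ⟧ * ⟦ does (p i ≟ᶠ z) ⟧))        ≡⟨ sum-cong-≗ (λ i → ∑-*ˡ ⟦ g i ⟧ (λ z → ⟦ does (p i ≟ᶠ z) ⟧)) ⟩
  ∑ (λ i → ⟦ g i ⟧ * ∑ (λ z → ⟦ does (p i ≟ᶠ z) ⟧))        ≡⟨ sum-cong-≗ (λ i → trans (cong (⟦ g i ⟧ *_) (∑-δ-1 (p i))) (*-identityʳ _)) ⟩
  ∑ (λ i → ⟦ g i ⟧)                                        ∎
  where
  open ≤-Reasoning
  bound : ∀ z → ⟦ f z ⟧ ≤ ∑ (λ i → ⟦ g i ⟧ * ⟦ does (p i ≟ᶠ z) ⟧)
  bound z with f z in eq
  ... | false = z≤n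
  ... | true with i , pi≡z , gi ← cover z eq =
    ≤-trans (≤-reflexive (≡.sym (cong₂ (λ b c → ⟦ b ⟧ * ⟦ c ⟧) gi (dec-true (p i ≟ᶠ z) pi≡z))))
            (term≤∑ (λ i → ⟦ g i ⟧ * ⟦ does (p i ≟ᶠ z) ⟧) i)

-- Edges, degrees and walks.

edges≡∑ : (G : Graph n) → edges G ≡ ∑ (λ i → ∑ (λ j → ⟦ (toℕ i <ᵇ toℕ j) ∧ adj G i j ⟧))
edges≡∑ {n} G = trans (sum-allFin {n} _) (sum-cong-≗ {n} (λ i → sum-allFin {n} _))

degree : Graph n → Fin n → ℕ
degree G v = ∑ (λ w → ⟦ adj G v w ⟧)

-- `edges` counts an edge at its smaller endpoint. Adding the transposed sum gives each off-diagonal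
-- entry of the adjacency matrix once, and the diagonal vanishes.
handshake : (G : Graph n) → edges G + edges G ≡ ∑ (degree G)
handshake {n} G = begin
  edges G + edges G
    ≡⟨ cong₂ _+_ (edges≡∑ G) (trans (edges≡∑ G) (∑-comm A)) ⟩
  ∑ (λ i → ∑ (λ j → A i j)) + ∑ (λ i → ∑ (λ j → A j i))
    ≡⟨ ∑-distrib-+ (λ i → ∑ (A i)) (λ i → ∑ (λ j → A j i)) ⟨
  ∑ (λ i → ∑ (A i) + ∑ (λ j → A j i))
    ≡⟨ sum-cong-≗ (λ i → trans (≡.sym (∑-distrib-+ (A i) (λ j → A j i))) (sum-cong-≗ (split i))) ⟩
  ∑ (degree G) ∎
  where
  open ≡-Reasoning
  A : Fin n → Fin n → ℕ
  A i j = ⟦ (toℕ i <ᵇ toℕ j) ∧ adj G i j ⟧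
  split : ∀ i j → A i j + A j i ≡ ⟦ adj G i j ⟧
  split i j rewrite sym G j i with <-cmp (toℕ i) (toℕ j)
  ... | tri< a _ c rewrite dec-true (toℕ i <? toℕ j) a | dec-false (toℕ j <? toℕ i) c = +-identityʳ _
  ... | tri> a _ c rewrite dec-false (toℕ i <? toℕ j) a | dec-true (toℕ j <? toℕ i) c = refl
  ... | tri≈ a b c rewrite dec-false (toℕ i <? toℕ j) a | dec-false (toℕ j <? toℕ i) c
                         | toℕ-injective b | irrefl G j = refl

adj⇒≢ : (G : Graph n) {u v : Fin n} → adj G u v ≡ true → u ≢ v
adj⇒≢ G {u} uv refl = case trans (≡.sym uv) (irrefl G u) of λ ()

adj-sym : (G : Graph n) {u v : Fin n} → adj G u v ≡ true → adj G v u ≡ true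
adj-sym G {u} {v} uv = trans (sym G v u) uv

walk-++ : {G : Graph n} {u v w : Fin n} → Walk G u v → Walk G v w → Walk G u w
walk-++ here        q = q
walk-++ (step e p)  q = step e (walk-++ p q)

walk-reverse : {G : Graph n} {u v : Fin n} → Walk G u v → Walk G v u
walk-reverse         here       = here
walk-reverse {G = G} (step e p) = walk-++ (walk-reverse p) (step (adj-sym G e) here)

-- The cut argument of both bounds: `B` is a ball in `distant-path` and an initial segment of
-- positions in `crossing`.
walk-exit : {G : Graph n} {u w : Fin n} (B : Fin n → Bool) → Walk G u w → B u ≡ true → B w ≡ false →
            ∃₂ λ x y → adj G x y ≡ true × B x ≡ true × B y ≡ false
walk-exit B here Bu Bw = case trans (≡.sym Bu) Bw of λ ()
walk-exit B (step {v = v} e p) Bu Bw with B v in eq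
... | true  = walk-exit B p eq Bw
... | false = _ , v , e , Bu , eq

-- Descent ends at the vertex numbered 0, and any two vertices are joined through it. Each descent
-- returns its own root, identified afterwards by its number, because `Fin n` offers no `zero` while
-- `n` is a variable.
descending⇒connected : (G : Graph n) →
  (∀ j → 0 < toℕ j → ∃ λ i → toℕ i < toℕ j × adj G j i ≡ true) → Connected G
descending⇒connected {n} G down u v =
  walk-++ (proj₂ (proj₂ (toRoot u)))
    (subst (λ r → Walk G r v) (toℕ-injective (trans (root≡0 v) (≡.sym (root≡0 u)))) (walk-reverse (proj₂ (proj₂ (toRoot v)))))
  where
  Root : ℕ → Set
  Root t = (j : Fin n) → toℕ j ≡ t → ∃ λ r → toℕ r ≡ 0 × Walk G j r
  rootFrom : ∀ t → Root t
  rootFrom = <-rec Root λ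
    { zero _ j j≡ → j , j≡ , here
    ; (suc t) rec j j≡ → let i , i<j , ji = down j (subst (0 <_) (≡.sym j≡) z<s)
                             r , r≡0 , p  = rec {toℕ i} (subst (toℕ i <_) j≡ i<j) i refl
                         in r , r≡0 , step ji p }
  toRoot : (j : Fin n) → ∃ λ r → toℕ r ≡ 0 × Walk G j r
  toRoot j = rootFrom (toℕ j) j refl
  root≡0 : ∀ j → toℕ (proj₁ (toRoot j)) ≡ 0
  root≡0 j = proj₁ (proj₂ (toRoot j))

-- Lets the lower bound split constructively on whether the hub graph contains `T`. Maps are
-- enumerated by codes; decoding agrees with the original map only pointwise, so both properties are
-- carried over pointwise.
contains? : (T : Graph m) (G : Graph n) → Dec (Contains T G)
contains? {m} {n} T G = map′ from to (any? embeds?)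
  where
  Embeds : (Fin m → Fin n) → Set
  Embeds f = (∀ i j → f i ≡ f j → i ≡ j) × (∀ u v → adj T u v ≡ true → adj G (f u) (f v) ≡ true)
  embeds? : ∀ c → Dec (Embeds (finToFun c))
  embeds? c =
    all? (λ i → all? (λ j → (finToFun c i ≟ᶠ finToFun c j) →-dec (i ≟ᶠ j))) ×-dec
    all? (λ u → all? (λ v → (adj T u v ≟ᵇ true) →-dec (adj G (finToFun c u) (finToFun c v) ≟ᵇ true)))
  from : (∃ λ c → Embeds (finToFun c)) → Contains T G
  from (c , inj , hom) = finToFun c , (λ {i} {j} → inj i j) , hom
  to : Contains T G → ∃ λ c → Embeds (finToFun c)
  to (f , inj , hom) = funToFin f ,
    (λ i j e → inj (trans (≡.sym (finToFun-funToFin f i)) (trans e (finToFun-funToFin f j)))) ,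
    (λ u v e → trans (cong₂ (adj G) (finToFun-funToFin f u) (finToFun-funToFin f v)) (hom u v e))

-- Graphs given by a decidable relation on numbers.

-- Broom, hub and beads are all instances. Reading `R` only from smaller to larger numbers excludes
-- loops and lets `edges` count the related pairs directly.
module Forward {R : ℕ → ℕ → Set} (R? : ∀ i j → Dec (R i j)) where

  Forward? : ∀ i j → Dec (i < j × R i j)
  Forward? i j = (i <? j) ×-dec R? i j

  graph : ∀ n → Graph n
  graph n .adj i j = does (Forward? (toℕ i) (toℕ j)) ∨ does (Forward? (toℕ j) (toℕ i))
  graph n .sym i j = ∨-comm (does (Forward? (toℕ i) (toℕ j))) _
  graph n .irrefl i rewrite dec-false (Forward? (toℕ i) (toℕ i)) (n≮n _ ∘ proj₁) = refl

  ⇒adj : {i j : Fin n} → toℕ i < toℕ j → R (toℕ i) (toℕ j) → adj (graph n) i j ≡ true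
  ⇒adj {i = i} {j} i<j r rewrite dec-true (Forward? (toℕ i) (toℕ j)) (i<j , r) = refl

  adj⇒ : {i j : Fin n} → adj (graph n) i j ≡ true →
         (toℕ i < toℕ j × R (toℕ i) (toℕ j)) ⊎ (toℕ j < toℕ i × R (toℕ j) (toℕ i))
  adj⇒ {i = i} {j} e = witness (Forward? (toℕ i) (toℕ j) ⊎-dec Forward? (toℕ j) (toℕ i)) e

  edges-graph : ∀ n → edges (graph n) ≡ ∑ {n} (λ i → ∑ {n} (λ j → ⟦ does (Forward? (toℕ i) (toℕ j)) ⟧))
  edges-graph n = trans (edges≡∑ (graph n)) (sum-cong-≗ {n} (λ i → sum-cong-≗ {n} (λ j → cong ⟦_⟧ (absorb (toℕ i) (toℕ j)))))
    where
    absorb : ∀ i j → (i <ᵇ j) ∧ (does (Forward? i j) ∨ does (Forward? j i)) ≡ does (Forward? i j)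
    absorb i j with i <? j
    ... | no  i≮j rewrite dec-false (i <? j) i≮j = refl
    ... | yes i<j rewrite dec-true (i <? j) i<j | dec-false (j <? i) (<⇒≯ i<j) with does (R? i j)
    ... | true = refl
    ... | false = refl

-- Paths with a fixed end.

-- The fixed end `v` is the last entry and growth happens at the head, so a path with `d` edges has
-- `v` at index `d`: the place of the broom's vertex from which the leaves hang.
data Path (G : Graph n) (v : Fin n) : Vec (Fin n) (suc d) → Set where
  start  : Path G v (v ∷ [])
  extend : ∀ {x y} {ys : Vec (Fin n) d} → adj G x y ≡ true → (∀ i → lookup (y ∷ ys) i ≢ x) →
           Path G v (y ∷ ys) → Path G v (x ∷ y ∷ ys)

module _ {G : Graph n} {v : Fin n} where

  path-injective : {p : Vec (Fin n) (suc d)} → Path G v p → Injective _≡_ _≡_ (lookup p)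
  path-injective start              {zero}  {zero}  _ = refl
  path-injective (extend _ x∉ p) {zero}  {zero}  _ = refl
  path-injective (extend _ x∉ p) {zero}  {suc j} e = contradiction (≡.sym e) (x∉ j)
  path-injective (extend _ x∉ p) {suc i} {zero}  e = contradiction e (x∉ i)
  path-injective (extend _ x∉ p) {suc i} {suc j} e = cong suc (path-injective p e)

  path-adj : {p : Vec (Fin n) (suc d)} → Path G v p → ∀ i j → toℕ j ≡ suc (toℕ i) →
             adj G (lookup p i) (lookup p j) ≡ true
  path-adj start          zero    zero          ()
  path-adj (extend e _ p) zero    (suc zero)    _ = e
  path-adj (extend e _ p) (suc i) (suc j)       h = path-adj p i j (suc-injective h)

  path-last : {p : Vec (Fin n) (suc d)} → Path G v p → ∀ i → toℕ i ≡ d → lookup p i ≡ v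
  path-last start          zero    _ = refl
  path-last (extend _ _ p) (suc i) h = path-last p i (suc-injective h)

  path-truncate : {p : Vec (Fin n) (suc d)} → k ≤ d → Path G v p → ∃ λ (q : Vec (Fin n) (suc k)) → Path G v q
  path-truncate {d = zero}  z≤n p = _ , p
  path-truncate {d = suc d} {k} k≤ p@(extend _ _ p′) with m≤n⇒m<n∨m≡n k≤
  ... | inj₁ (s≤s k≤d) = path-truncate k≤d p′
  ... | inj₂ refl      = _ , p

  path-to : {p : Vec (Fin n) (suc d)} → Path G v p → ∀ i →
            ∃₂ λ k (q : Vec (Fin n) k) → Path G v (lookup p i ∷ q)
  path-to start            zero    = _ , _ , start
  path-to p@(extend _ _ _) zero    = _ , _ , p
  path-to (extend _ _ p)   (suc i) = path-to p i

  -- Loop erasure: when the walk returns to a vertex of the path, the path is cut back to that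
  -- vertex. Length is not controlled here; `greedy` provides it.
  prolong : ∀ {u h} {q : Vec (Fin n) d} → Path G v (u ∷ q) → Walk G u h →
            ∃₂ λ k (r : Vec (Fin n) k) → Path G v (h ∷ r)
  prolong p here = _ , _ , p
  prolong {u = u} {q = q} p (step {v = w} e walk) with any? (λ i → lookup (u ∷ q) i ≟ᶠ w)
  ... | no  w∉        = prolong (extend (adj-sym G e) (λ i eq → w∉ (i , eq)) p) walk
  ... | yes (i , refl) = prolong (proj₂ (proj₂ (path-to p i))) walk

-- Subgraphs of large minimum degree and long paths.

induced : Graph n → (Fin n → Bool) → Fin n → ℕ
induced G W u = ∑ (λ w → ⟦ W w ⟧ * ⟦ adj G u w ⟧)

induced-≤ : (G : Graph n) (W : Fin n → Bool) (u : Fin n) (p : Fin m → Fin n) →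
  (∀ z → W z ≡ true → adj G u z ≡ true → ∃ λ i → p i ≡ z) → induced G W u ≤ m
induced-≤ {n} {m} G W u p cover = begin
  induced G W u                          ≡⟨ sum-cong-≗ {n} (λ w → ∧-* (W w) (adj G u w)) ⟨
  ∑ (λ w → ⟦ W w ∧ adj G u w ⟧)          ≤⟨ count-cover (λ w → W w ∧ adj G u w) (λ _ → true) p covered ⟩
  ∑ {m} (λ _ → 1)                        ≡⟨ trans (∑-const m 1) (*-identityʳ m) ⟩
  m                                      ∎
  where
  open ≤-Reasoning
  ∧-* : ∀ a b → ⟦ a ∧ b ⟧ ≡ ⟦ a ⟧ * ⟦ b ⟧
  ∧-* true  b = ≡.sym (+-identityʳ _)
  ∧-* false b = refl
  covered : ∀ z → W z ∧ adj G u z ≡ true → ∃ λ i → p i ≡ z × true ≡ true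
  covered z h with W z in Wz | adj G u z in uz
  ... | true | true = let i , e = cover z Wz uz in i , e , refl

-- When no neighbour of the head `x` in `H` is off the path, all of them are among the `d` entries
-- of `xs`, so `dense` forces `P ≤ d`. `k` is fuel; the part of the path behind `x` may lie outside
-- `H`.
greedy : (G : Graph n) (v : Fin n) (P : ℕ) (H : Fin n → Bool) → (∀ h → H h ≡ true → P ≤ induced G H h) →
  ∀ k {d x} {xs : Vec (Fin n) d} → P ≤ d + k → H x ≡ true → Path G v (x ∷ xs) →
  ∃ λ (p : Vec (Fin n) (suc P)) → Path G v p
greedy G v P H dense zero    {d} P≤ Hx p = path-truncate (≤-trans P≤ (≤-reflexive (+-identityʳ d))) p
greedy G v P H dense (suc k) {d} {x} {xs} P≤ Hx p with P ≤? d
... | yes P≤d = path-truncate P≤d p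
... | no  P≰d with any? (λ z → (H z ≟ᵇ true) ×-dec (adj G x z ≟ᵇ true) ×-dec ¬? (any? (λ i → lookup xs i ≟ᶠ z)))
... | yes (z , Hz , xz , z∉) =
  greedy G v P H dense k (≤-trans P≤ (≤-reflexive (+-suc d k))) Hz (extend (adj-sym G xz) fresh p)
  where
  fresh : ∀ i → lookup (x ∷ xs) i ≢ z
  fresh zero    = adj⇒≢ G xz
  fresh (suc i) = λ e → z∉ (i , e)
... | no none = contradiction (≤-trans (dense x Hx) (induced-≤ G H x (lookup xs) old)) P≰d
  where
  old : ∀ z → H z ≡ true → adj G x z ≡ true → ∃ λ i → lookup xs i ≡ z
  old z Hz xz with any? (λ i → lookup xs i ≟ᶠ z)
  ... | yes i = i
  ... | no  z∉ = contradiction (z , Hz , xz , z∉) none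

-- The degree sum of the induced subgraph, twice its number of edges.
volume : Graph n → (Fin n → Bool) → ℕ
volume G W = ∑ (λ u → ⟦ W u ⟧ * induced G W u)

DenseSubset : Graph n → ℕ → Set
DenseSubset {n} G P = Σ (Fin n → Bool) λ H → (∃ λ h → H h ≡ true) × (∀ h → H h ≡ true → P ≤ induced G H h)

module Removal (G : Graph n) (W : Fin n → Bool) (u : Fin n) (Wu : W u ≡ true) where

  W′ : Fin n → Bool
  W′ w = W w ∧ not (does (u ≟ᶠ w))

  split : ∀ w → ⟦ W w ⟧ ≡ ⟦ W′ w ⟧ + ⟦ does (u ≟ᶠ w) ⟧
  split w with u ≟ᶠ w
  ... | yes refl rewrite Wu = refl
  ... | no  _ with W w
  ... | true  = refl
  ... | false = refl

  size-remove : ∑ (λ w → ⟦ W w ⟧) ≡ suc (∑ (λ w → ⟦ W′ w ⟧))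
  size-remove = begin
    ∑ (λ w → ⟦ W w ⟧)                                          ≡⟨ sum-cong-≗ split ⟩
    ∑ (λ w → ⟦ W′ w ⟧ + ⟦ does (u ≟ᶠ w) ⟧)                     ≡⟨ ∑-distrib-+ (λ w → ⟦ W′ w ⟧) (λ w → ⟦ does (u ≟ᶠ w) ⟧) ⟩
    ∑ (λ w → ⟦ W′ w ⟧) + ∑ (λ w → ⟦ does (u ≟ᶠ w) ⟧)           ≡⟨ cong (∑ (λ w → ⟦ W′ w ⟧) +_) (∑-δ-1 u) ⟩
    ∑ (λ w → ⟦ W′ w ⟧) + 1                                     ≡⟨ +-comm _ 1 ⟩
    suc (∑ (λ w → ⟦ W′ w ⟧))                                   ∎
    where open ≡-Reasoning

  ∑-remove : (f : Fin n → ℕ) → ∑ (λ w → ⟦ W w ⟧ * f w) ≡ ∑ (λ w → ⟦ W′ w ⟧ * f w) + f u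
  ∑-remove f = begin
    ∑ (λ w → ⟦ W w ⟧ * f w)
      ≡⟨ sum-cong-≗ (λ w → trans (cong (_* f w) (split w)) (*-distribʳ-+ (f w) ⟦ W′ w ⟧ _)) ⟩
    ∑ (λ w → ⟦ W′ w ⟧ * f w + ⟦ does (u ≟ᶠ w) ⟧ * f w)
      ≡⟨ ∑-distrib-+ (λ w → ⟦ W′ w ⟧ * f w) (λ w → ⟦ does (u ≟ᶠ w) ⟧ * f w) ⟩
    ∑ (λ w → ⟦ W′ w ⟧ * f w) + ∑ (λ w → ⟦ does (u ≟ᶠ w) ⟧ * f w)
      ≡⟨ cong (∑ (λ w → ⟦ W′ w ⟧ * f w) +_) (∑-δ f u) ⟩
    ∑ (λ w → ⟦ W′ w ⟧ * f w) + f u ∎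
    where open ≡-Reasoning

  -- Deleting `u` removes its row, `induced G W u`, and its column, which symmetry turns into
  -- `induced G W′ u`.
  volume-remove : volume G W ≡ volume G W′ + induced G W′ u + induced G W u
  volume-remove = trans (∑-remove (induced G W)) (cong (_+ induced G W u) (begin
    ∑ (λ w → ⟦ W′ w ⟧ * induced G W w)
      ≡⟨ sum-cong-≗ (λ w → trans (cong (⟦ W′ w ⟧ *_) (∑-remove (λ z → ⟦ adj G w z ⟧))) (*-distribˡ-+ ⟦ W′ w ⟧ _ _)) ⟩
    ∑ (λ w → ⟦ W′ w ⟧ * induced G W′ w + ⟦ W′ w ⟧ * ⟦ adj G w u ⟧)
      ≡⟨ ∑-distrib-+ (λ w → ⟦ W′ w ⟧ * induced G W′ w) (λ w → ⟦ W′ w ⟧ * ⟦ adj G w u ⟧) ⟩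
    volume G W′ + ∑ (λ w → ⟦ W′ w ⟧ * ⟦ adj G w u ⟧)
      ≡⟨ cong (volume G W′ +_) (sum-cong-≗ {n} (λ w → cong (λ b → ⟦ W′ w ⟧ * ⟦ b ⟧) (sym G w u))) ⟩
    volume G W′ + induced G W′ u ∎))
    where open ≡-Reasoning

  induced-remove : induced G W′ u ≤ induced G W u
  induced-remove = ≤-trans (m≤m+n _ _) (≤-reflexive (≡.sym (∑-remove (λ z → ⟦ adj G u z ⟧))))

-- Vertices with fewer than `P` neighbours in the current set are deleted one by one, each costing
-- at most 2P of `volume`. Either this halts at a nonempty set, which is dense, or everything goes
-- and the costs add up to the bound.
peel : (G : Graph n) (P : ℕ) → ∀ k (W : Fin n → Bool) → ∑ (λ w → ⟦ W w ⟧) ≡ k →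
       DenseSubset G P ⊎ volume G W ≤ k * (P + P)
peel {n} G P k W size with any? (λ u → (W u ≟ᵇ true) ×-dec (induced G W u <? P))
peel {n} G P k W size | no none with any? (λ u → W u ≟ᵇ true)
... | yes nonempty = inj₁ (W , nonempty , λ h Wh → ≮⇒≥ (λ lt → none (h , Wh , lt)))
... | no  empty    = inj₂ (≤-trans (≤-reflexive (∑-zero vanish)) z≤n)
  where
  vanish : ∀ u → ⟦ W u ⟧ * induced G W u ≡ 0
  vanish u with W u in Wu
  ... | true  = contradiction (u , Wu) empty
  ... | false = refl
peel {n} G P k W size | yes (u , Wu , sparse) = remove k size
  where
  open Removal G W u Wu
  remove : ∀ k → ∑ (λ w → ⟦ W w ⟧) ≡ k → DenseSubset G P ⊎ volume G W ≤ k * (P + P)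
  remove zero    e = case trans (≡.sym e) size-remove of λ ()
  remove (suc k) e with peel G P k W′ (suc-injective (trans (≡.sym size-remove) e))
  ... | inj₁ H = inj₁ H
  ... | inj₂ le = inj₂ (begin
    volume G W                                         ≡⟨ trans volume-remove (+-assoc (volume G W′) _ _) ⟩
    volume G W′ + (induced G W′ u + induced G W u)     ≤⟨ +-mono-≤ le (+-mono-≤ (≤-trans induced-remove (<⇒≤ sparse)) (<⇒≤ sparse)) ⟩
    k * (P + P) + (P + P)                              ≡⟨ +-comm _ (P + P) ⟩
    suc k * (P + P)                                    ∎)
    where open ≤-Reasoning

long-path : (G : Graph n) (P : ℕ) → Connected G → n * (P + P) < edges G + edges G →
            ∀ v → ∃ λ (p : Vec (Fin n) (suc P)) → Path G v p
long-path {n} G P conn dense v with peel G P n (λ _ → true) (trans (∑-const n 1) (*-identityʳ n))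
-- A walk from `v` into the dense set becomes a path ending at `v`, which `greedy` lengthens inside
-- that set; fuel `P` suffices whatever the initial length.
... | inj₁ (H , (h , Hh) , deg) = let _ , _ , p = prolong start (conn v h) in greedy G v P H deg P (m≤n+m P _) Hh p
... | inj₂ le = contradiction (≤-trans (≤-reflexive total) le) (<⇒≱ dense)
  where
  total : edges G + edges G ≡ volume G (λ _ → true)
  total = trans (handshake G) (sum-cong-≗ {n} (λ u → ≡.sym (trans (+-identityʳ _) (sum-cong-≗ {n} (λ w → +-identityʳ _)))))

-- Balls and geodesics.

ball : Graph n → Fin n → ℕ → Fin n → Bool
ball G v zero    u = does (v ≟ᶠ u)
ball G v (suc d) u = ball G v d u ∨ does (any? (λ w → (ball G v d w ≟ᵇ true) ×-dec (adj G u w ≟ᵇ true)))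

module _ (G : Graph n) (v : Fin n) where

  ball-grows : ∀ d {u} → ball G v d u ≡ true → ball G v (suc d) u ≡ true
  ball-grows d e rewrite e = refl

  ball-monotone : ∀ {d} e {u} → d ≤ e → ball G v d u ≡ true → ball G v e u ≡ true
  ball-monotone e d≤e h with m≤n⇒m<n∨m≡n d≤e
  ball-monotone (suc e) _ h | inj₁ (s≤s d≤e) = ball-grows e (ball-monotone e d≤e h)
  ball-monotone e       _ h | inj₂ refl      = h

  ball-neighbour : ∀ d {u w} → ball G v d w ≡ true → adj G u w ≡ true → ball G v (suc d) u ≡ true
  ball-neighbour d {u} Bw uw with ball G v d u
  ... | true  = refl
  ... | false = dec-true (any? (λ w → (ball G v d w ≟ᵇ true) ×-dec (adj G u w ≟ᵇ true))) (_ , Bw , uw)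

  ball-step : ∀ d {u} → ball G v (suc d) u ≡ true → ball G v d u ≡ false →
              ∃ λ w → ball G v d w ≡ true × adj G u w ≡ true
  ball-step d Bu ¬Bu rewrite ¬Bu = witness (any? (λ w → (ball G v d w ≟ᵇ true) ×-dec (adj G _ w ≟ᵇ true))) Bu

  -- The next ball consists of the old one and at most `Δ` neighbours per member, so its size grows
  -- by a factor of at most `suc Δ`.
  ball-size : ∀ Δ → (∀ u → degree G u ≤ Δ) → ∀ d → ∑ (λ u → ⟦ ball G v d u ⟧) ≤ suc Δ ^ d
  ball-size Δ bounded zero    = ≤-reflexive (∑-δ-1 v)
  ball-size Δ bounded (suc d) = begin
    ∑ (λ u → ⟦ ball G v (suc d) u ⟧)                              ≤⟨ ∑-mono bound ⟩
    ∑ (λ u → B u + ∑ (λ w → B w * A u w))                         ≡⟨ ∑-distrib-+ B (λ u → ∑ (λ w → B w * A u w)) ⟩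
    ∑ B + ∑ (λ u → ∑ (λ w → B w * A u w))                         ≡⟨ cong (∑ B +_) (∑-comm (λ u w → B w * A u w)) ⟩
    ∑ B + ∑ (λ w → ∑ (λ u → B w * A u w))                         ≤⟨ +-monoʳ-≤ (∑ B) (∑-mono spread) ⟩
    ∑ B + ∑ (λ w → B w * Δ)                                       ≡⟨ cong (∑ B +_) (trans (∑-*ʳ Δ B) (*-comm (∑ B) Δ)) ⟩
    suc Δ * ∑ B                                                   ≤⟨ *-monoʳ-≤ (suc Δ) (ball-size Δ bounded d) ⟩
    suc Δ ^ suc d                                                 ∎
    where
    open ≤-Reasoning
    B : Fin n → ℕ
    B u = ⟦ ball G v d u ⟧
    A : Fin n → Fin n → ℕ
    A u w = ⟦ adj G u w ⟧
    bound : ∀ u → ⟦ ball G v (suc d) u ⟧ ≤ B u + ∑ (λ w → B w * A u w)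
    bound u with ball G v d u
    ... | true  = m≤m+n 1 _
    ... | false with any? (λ w → (ball G v d w ≟ᵇ true) ×-dec (adj G u w ≟ᵇ true))
    ... | no  _             = z≤n
    ... | yes (w , Bw , uw) =
      ≤-trans (≤-reflexive (≡.sym (cong₂ (λ b c → ⟦ b ⟧ * ⟦ c ⟧) Bw uw))) (term≤∑ (λ w → B w * A u w) w)
    spread : ∀ w → ∑ (λ u → B w * A u w) ≤ B w * Δ
    spread w = ≤-trans (≤-reflexive (∑-*ˡ (B w) (λ u → A u w)))
      (*-monoʳ-≤ (B w) (≤-trans (≤-reflexive (sum-cong-≗ {n} (λ u → cong ⟦_⟧ (sym G u w)))) (bounded w)))

  contacts : Vec (Fin n) d → ℕ
  contacts {d} p = ∑ {d} (λ i → ⟦ adj G v (lookup p i) ⟧)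

  -- A geodesic from v meets the neighbourhood of v only in its first step.
  geodesic : ∀ d u → ball G v (suc d) u ≡ true → ball G v d u ≡ false →
    ∃ λ (xs : Vec (Fin n) (suc d)) → Path G v (u ∷ xs) × (∀ i → ball G v d (lookup xs i) ≡ true) × contacts (u ∷ xs) ≤ 1
  geodesic zero u Bu ¬Bu with w , Bw , uw ← ball-step zero Bu ¬Bu with refl ← witness (v ≟ᶠ w) Bw =
    v ∷ [] , extend uw (λ { zero → adj⇒≢ G (adj-sym G uw) }) start , (λ { zero → Bw }) ,
    ≤-trans (+-monoʳ-≤ ⟦ adj G v u ⟧ (≤-reflexive (cong (λ b → ⟦ b ⟧ + 0) (irrefl G v)))) (≤-trans (≤-reflexive (+-identityʳ _)) (⟦⟧≤1 (adj G v u)))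
  geodesic (suc d) u Bu ¬Bu with w , Bw , uw ← ball-step (suc d) Bu ¬Bu with ball G v d w ≟ᵇ true
  -- With `w` in the smaller ball, `u` would already lie in the ball of radius `suc d`; so the
  -- distance drops by exactly one per step.
  ... | yes Bdw = case trans (≡.sym (ball-neighbour d Bdw uw)) ¬Bu of λ ()
  ... | no ¬Bdw with ws , p , ws⊆ , few ← geodesic d w Bw (¬-not ¬Bdw) =
    w ∷ ws , extend uw fresh p , inside , ≤-trans (≤-reflexive (cong (_+ contacts (w ∷ ws)) (cong ⟦_⟧ apart))) few
    where
    inside : ∀ i → ball G v (suc d) (lookup (w ∷ ws) i) ≡ true
    inside zero    = Bw
    inside (suc i) = ball-grows d (ws⊆ i)
    fresh : ∀ i → lookup (w ∷ ws) i ≢ u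
    fresh i refl = case trans (≡.sym (inside i)) ¬Bu of λ ()
    -- `u` is outside a ball of radius at least 1, which contains all neighbours of `v`.
    apart : adj G v u ≡ false
    apart with adj G v u in e
    ... | false = refl
    ... | true  = case trans (≡.sym (ball-monotone (suc d) (s≤s z≤n) (ball-neighbour 0 (dec-true (v ≟ᶠ v) refl) (adj-sym G e)))) ¬Bu of λ ()

  -- If the ball of radius `d` is everything, its size contradicts `large`. Otherwise a walk out of
  -- it first meets a vertex at distance exactly `suc d`, from which `geodesic` runs back to `v`.
  distant-path : Connected G → ∀ Δ → (∀ u → degree G u ≤ Δ) → ∀ d → suc Δ ^ d < n →
    ∃ λ (p : Vec (Fin n) (suc (suc d))) → Path G v p × contacts p ≤ 1
  distant-path conn Δ bounded d large with all? (λ u → ball G v d u ≟ᵇ true)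
  ... | yes everything = contradiction (≤-trans (≤-reflexive full) (ball-size Δ bounded d)) (<⇒≱ large)
    where
    full : n ≡ ∑ (λ u → ⟦ ball G v d u ⟧)
    full = ≡.sym (trans (sum-cong-≗ {n} (λ u → cong ⟦_⟧ (everything u))) (trans (∑-const n 1) (*-identityʳ n)))
  ... | no ¬everything with u , ¬Bu ← ¬∀⟶∃¬ n _ (λ u → ball G v d u ≟ᵇ true) ¬everything
    with x , y , xy , Bx , ¬By ← walk-exit (ball G v d) (conn v u) (ball-monotone d z≤n (dec-true (v ≟ᶠ v) refl)) (¬-not ¬Bu)
    with xs , p , _ , few ← geodesic d y (ball-neighbour d Bx (adj-sym G xy)) ¬By = y ∷ xs , p , few

-- The broom and the upper bound.

-- The broom has the path 0, …, P, and its 2P leaves P + 1, …, 3P hang from P.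
parent : ℕ → ℕ → ℕ
parent P j = (j ∸ 1) ⊓ P

module Broom (P : ℕ) = Forward (λ i j → i ≟ parent P j)

broom : ∀ P → Graph (suc P + (P + P))
broom P = Broom.graph P (suc P + (P + P))

parent-< : ∀ P j → parent P (suc j) < suc j
parent-< P j = s≤s (m⊓n≤m j P)

-- Every vertex but 0 has exactly one smaller neighbour, its parent. This gives the descent for
-- connectedness, and counting edges by their larger endpoint gives one per nonzero vertex.
broom-tree : ∀ P → IsTree (broom P)
broom-tree P = descending⇒connected (broom P) down , trans (cong (_+ 1) count) (+-comm _ 1)
  where
  open Broom P
  M = P + (P + P)
  par : Fin M → Fin (suc M)
  par j = fromℕ< (<-trans (parent-< P (toℕ j)) (s≤s (toℕ<n j)))
  toℕ-par : ∀ j → toℕ (par j) ≡ parent P (suc (toℕ j))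
  toℕ-par j = toℕ-fromℕ< _
  down : ∀ j → 0 < toℕ j → ∃ λ i → toℕ i < toℕ j × adj (broom P) j i ≡ true
  down (suc j) _ = par j , lt , adj-sym (broom P) {par j} {suc j} (⇒adj {i = par j} {suc j} lt (toℕ-par j))
    where
    lt : toℕ (par j) < suc (toℕ j)
    lt = ≤-trans (s≤s (≤-reflexive (toℕ-par j))) (parent-< P (toℕ j))
  F : Fin (suc M) → Fin (suc M) → ℕ
  F i j = ⟦ does (Forward? (toℕ i) (toℕ j)) ⟧
  only : ∀ j i → F i (suc j) ≡ ⟦ does (par j ≟ᶠ i) ⟧
  only j i with par j ≟ᶠ i
  ... | yes refl = cong ⟦_⟧ (dec-true (Forward? (toℕ (par j)) (suc (toℕ j)))
                     (≤-trans (s≤s (≤-reflexive (toℕ-par j))) (parent-< P (toℕ j)) , toℕ-par j))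
  ... | no  ≢i   = cong ⟦_⟧ (dec-false (Forward? (toℕ i) (suc (toℕ j)))
                     (λ (_ , e) → ≢i (toℕ-injective (trans (toℕ-par j) (≡.sym e)))))
  count : edges (broom P) ≡ M
  count = begin
    edges (broom P)                              ≡⟨ edges-graph (suc M) ⟩
    ∑ (λ i → ∑ (λ j → F i j))                    ≡⟨ ∑-comm F ⟩
    ∑ (λ i → F i zero) + ∑ (λ j → ∑ (λ i → F i (suc j)))
      ≡⟨ cong₂ _+_ (∑-zero {suc M} (λ i → cong ⟦_⟧ (dec-false (Forward? (toℕ i) 0) (λ ()))))
                   (sum-cong-≗ {M} (λ j → trans (sum-cong-≗ {suc M} (only j)) (∑-δ-1 (par j)))) ⟩
    ∑ {M} (λ _ → 1)                              ≡⟨ trans (∑-const M 1) (*-identityʳ M) ⟩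
    M                                            ∎
    where open ≡-Reasoning

-- The handle goes onto the path, with index `P` at `v`. The neighbours of `v` off the path number
-- at least `degree G v` less the contacts, which leaves 2P of them for the leaves.
broom-embeds : (G : Graph n) (v : Fin n) (P : ℕ) {p : Vec (Fin n) (suc P)} → Path G v p →
               P + P + contacts G v p ≤ degree G v → Contains (broom P) G
broom-embeds {n} G v P {p} path big = place ∘ splitAt (suc P) , injective , hom
  where
  on? : ∀ z → Dec (∃ λ i → lookup p i ≡ z)
  on? z = any? (λ i → lookup p i ≟ᶠ z)

  leaf : Fin n → Bool
  leaf z = adj G v z ∧ not (does (on? z))

  many : degree G v ≤ ∑ (λ z → ⟦ leaf z ⟧) + contacts G v p
  many = begin
    degree G v
      ≡⟨ sum-cong-≗ {n} (λ z → split (adj G v z) (does (on? z))) ⟩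
    ∑ (λ z → ⟦ leaf z ⟧ + ⟦ adj G v z ∧ does (on? z) ⟧)
      ≡⟨ ∑-distrib-+ (λ z → ⟦ leaf z ⟧) (λ z → ⟦ adj G v z ∧ does (on? z) ⟧) ⟩
    ∑ (λ z → ⟦ leaf z ⟧) + ∑ (λ z → ⟦ adj G v z ∧ does (on? z) ⟧)
      ≤⟨ +-monoʳ-≤ _ (count-cover (λ z → adj G v z ∧ does (on? z)) (λ i → adj G v (lookup p i)) (lookup p) covered) ⟩
    ∑ (λ z → ⟦ leaf z ⟧) + contacts G v p ∎
    where
    open ≤-Reasoning
    split : ∀ a b → ⟦ a ⟧ ≡ ⟦ a ∧ not b ⟧ + ⟦ a ∧ b ⟧
    split true  true  = refl
    split true  false = refl
    split false b     = refl
    covered : ∀ z → adj G v z ∧ does (on? z) ≡ true → ∃ λ i → lookup p i ≡ z × adj G v (lookup p i) ≡ true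
    covered z h with i , refl ← witness (on? z) (∧-conicalʳ (adj G v z) _ h) = i , refl , ∧-conicalˡ _ _ h

  leaves : Σ (Fin (P + P) → Fin n) λ ι → Injective _≡_ _≡_ ι × (∀ i → leaf (ι i) ≡ true)
  leaves = pick leaf (+-cancelʳ-≤ (contacts G v p) _ _ (≤-trans big many))

  ι : Fin (P + P) → Fin n
  ι = proj₁ leaves

  ι-leaf : ∀ b → adj G v (ι b) ≡ true × (∀ i → lookup p i ≢ ι b)
  ι-leaf b = let h = proj₂ (proj₂ leaves) b in
    ∧-conicalˡ _ _ h , λ i e → witness (¬? (on? (ι b))) (∧-conicalʳ (adj G v (ι b)) _ h) (i , e)

  place : Fin (suc P) ⊎ Fin (P + P) → Fin n
  place = [ lookup p , ι ]′

  place-injective : ∀ x y → place x ≡ place y → x ≡ y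
  place-injective (inj₁ a) (inj₁ b) e = cong inj₁ (path-injective path e)
  place-injective (inj₁ a) (inj₂ b) e = contradiction e (proj₂ (ι-leaf b) a)
  place-injective (inj₂ a) (inj₁ b) e = contradiction (≡.sym e) (proj₂ (ι-leaf a) b)
  place-injective (inj₂ a) (inj₂ b) e = cong inj₂ (proj₁ (proj₂ leaves) e)

  injective : Injective _≡_ _≡_ (place ∘ splitAt (suc P))
  injective {i} {j} e = begin
    i                                        ≡⟨ join-splitAt (suc P) (P + P) i ⟨
    join (suc P) (P + P) (splitAt (suc P) i) ≡⟨ cong (join (suc P) (P + P)) (place-injective (splitAt (suc P) i) (splitAt (suc P) j) e) ⟩
    join (suc P) (P + P) (splitAt (suc P) j) ≡⟨ join-splitAt (suc P) (P + P) j ⟩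
    j                                        ∎
    where open ≡-Reasoning

  place-parent : ∀ x y → toℕ (join (suc P) (P + P) x) < toℕ (join (suc P) (P + P) y) →
    toℕ (join (suc P) (P + P) x) ≡ parent P (toℕ (join (suc P) (P + P) y)) → adj G (place x) (place y) ≡ true
  -- Leaves are numbered above `P` and parents at most `P`, so no leaf is a parent.
  place-parent (inj₂ a) y _ e = contradiction
    (≤-trans (≤-reflexive (trans (≡.sym (toℕ-↑ʳ (suc P) a)) e)) (m⊓n≤n (toℕ (join (suc P) (P + P) y) ∸ 1) P))
    (<⇒≱ (m≤m+n (suc P) (toℕ a)))
  place-parent (inj₁ a) (inj₁ (suc b)) _ e = path-adj path a (suc b) (cong suc (begin
    toℕ b               ≡⟨ m≤n⇒m⊓n≡m (<⇒≤ (toℕ<n b)) ⟨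
    toℕ b ⊓ P           ≡⟨ cong (_⊓ P) (toℕ-↑ˡ b (P + P)) ⟨
    toℕ (b ↑ˡ (P + P)) ⊓ P ≡⟨ e ⟨
    toℕ (a ↑ˡ (P + P))  ≡⟨ toℕ-↑ˡ a (P + P) ⟩
    toℕ a               ∎))
    where open ≡-Reasoning
  place-parent (inj₁ a) (inj₂ b) _ e =
    subst (λ z → adj G z (ι b) ≡ true) (≡.sym (path-last path a (begin
      toℕ a                   ≡⟨ toℕ-↑ˡ a (P + P) ⟨
      toℕ (a ↑ˡ (P + P))      ≡⟨ e ⟩
      toℕ (P ↑ʳ b) ⊓ P        ≡⟨ cong (_⊓ P) (toℕ-↑ʳ P b) ⟩
      (P + toℕ b) ⊓ P         ≡⟨ m≥n⇒m⊓n≡n (m≤m+n P (toℕ b)) ⟩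
      P                       ∎))) (proj₁ (ι-leaf b))
    where open ≡-Reasoning

  edge : ∀ i j → toℕ i < toℕ j → toℕ i ≡ parent P (toℕ j) → adj G (place (splitAt (suc P) i)) (place (splitAt (suc P) j)) ≡ true
  edge i j i<j e = place-parent (splitAt (suc P) i) (splitAt (suc P) j)
    (≡.subst₂ _<_ (same i) (same j) i<j) (≡.subst₂ (λ a b → a ≡ parent P b) (same i) (same j) e)
    where
    same : ∀ i → toℕ i ≡ toℕ (join (suc P) (P + P) (splitAt (suc P) i))
    same i = cong toℕ (≡.sym (join-splitAt (suc P) (P + P) i))

  hom : ∀ u w → adj (broom P) u w ≡ true → adj G (place (splitAt (suc P) u)) (place (splitAt (suc P) w)) ≡ true
  hom u w uw with Broom.adj⇒ P {i = u} {w} uw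
  ... | inj₁ (lt , e) = edge u w lt e
  ... | inj₂ (lt , e) = adj-sym G (edge w u lt e)

-- Write Q = `suc P`. A vertex of degree at least 3Q + 1 keeps 2Q neighbours off any path of Q + 1
-- vertices, so too many edges would give a broom through `long-path`. Otherwise either all degrees
-- are at most 2Q and `handshake` concludes, or a degree of at least 2Q + 1 and a path with at most
-- one contact give a broom. The size condition is that of `distant-path` with maximum degree 3Q + 1
-- and radius `P`.
broom-turán : (P : ℕ) (G : Graph n) → Connected G → suc (suc P + suc P + suc (suc P)) ^ P < n →
              ¬ Contains (broom (suc P)) G → edges G + edges G ≤ n * (suc P + suc P)
broom-turán {n} P G conn large free with any? (λ v → suc P + suc P + suc (suc P) ≤? degree G v)
... | yes (v , big) = ≮⇒≥ λ dense → let p , path = long-path G (suc P) conn dense v in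
  free (broom-embeds G v (suc P) path (≤-trans (+-monoʳ-≤ (suc P + suc P)
    (≤-trans (∑-mono (λ i → ⟦⟧≤1 (adj G v (lookup p i)))) (≤-reflexive (trans (∑-const (suc (suc P)) 1) (*-identityʳ _))))) big))
... | no  small with any? (λ v → suc P + suc P <? degree G v)
... | no  tiny = ≤-trans (≤-reflexive (handshake G)) (≤-trans (∑-mono (λ v → ≮⇒≥ (λ lt → tiny (v , lt)))) (≤-reflexive (∑-const n _)))
... | yes (v , lt) with p , path , few ← distant-path G v conn _ (λ u → <⇒≤ (≰⇒> λ le → small (u , le))) P large =
  contradiction (broom-embeds G v (suc P) path (≤-trans (+-monoʳ-≤ (suc P + suc P) few) (≤-trans (≤-reflexive (+-comm _ 1)) lt))) free

gammaUpper : GammaUpper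
gammaUpper k q _ = suc (suc P) + (suc P + suc P) , k≤m , 4≤m , broom (suc P) , broom-tree (suc P) ,
  suc (suc (suc P + suc P + suc (suc P)) ^ P) , λ n n> G conn free → begin
    6 * q * edges G                                     ≡⟨ double q (edges G) ⟩
    3 * q * (edges G + edges G)                         ≤⟨ *-monoʳ-≤ (3 * q) (broom-turán P G conn n> free) ⟩
    -- With Q = `suc P`, the slack (2q + 3)(3Q - 1) - 6qQ is 9Q - 2q - 3, which for Q = q + k + 1 is
    -- the coefficient added here.
    3 * q * (n * (suc P + suc P))                       ≤⟨ m≤m+n _ ((7 * q + 9 * k + 6) * n) ⟩
    3 * q * (n * (suc P + suc P)) + (7 * q + 9 * k + 6) * n ≡⟨ collect q k n ⟩
    (2 * q + 3) * (P + (suc P + suc P)) * n             ∎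
  where
  open ≤-Reasoning
  P : ℕ
  -- The summand `k` makes the broom large; `q` brings 2Q/(3Q - 1), where Q = `suc P`, below 2/3 +
  -- 1/q.
  P = q + k
  double : ∀ q e → 6 * q * e ≡ 3 * q * (e + e)
  double = solve-∀
  collect : ∀ q k n → 3 * q * (n * (suc (q + k) + suc (q + k))) + (7 * q + 9 * k + 6) * n
                    ≡ (2 * q + 3) * ((q + k) + (suc (q + k) + suc (q + k))) * n
  collect = solve-∀
  k≤m : k ≤ suc (suc P) + (suc P + suc P)
  k≤m = ≤-trans (m≤n+m k q) (≤-trans (m≤n+m P 2) (m≤m+n (2 + P) _))
  4≤m : 4 ≤ suc (suc P) + (suc P + suc P)
  4≤m = +-mono-≤ {2} {suc (suc P)} {2} {suc P + suc P} (s≤s (s≤s z≤n)) (+-mono-≤ {1} {suc P} {1} {suc P} (s≤s z≤n) (s≤s z≤n))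

-- The hub graph.

-- A copy of T in this graph yields a vertex cover of T of size at most s: the vertices placed below s.
module Hub (s : ℕ) = Forward (λ i _ → i <? s)

hub-connected : ∀ s n → 0 < s → Connected (Hub.graph s n)
hub-connected s n s>0 = descending⇒connected (Hub.graph s n) down
  where
  down : ∀ j → 0 < toℕ j → ∃ λ i → toℕ i < toℕ j × adj (Hub.graph s n) j i ≡ true
  down j@(suc _) _ = zero , z<s , adj-sym (Hub.graph s n) {zero} {j} (Hub.⇒adj s {i = zero} {j} z<s s>0)

-- Only the pairs joining the hub to the other `r` vertices are counted.
hub-edges : ∀ s r → s * r ≤ edges (Hub.graph s (s + r))
hub-edges s r = begin
  s * r                                        ≡⟨ trans (sum-cong-≗ {s} (λ _ → trans (∑-const r 1) (*-identityʳ r))) (∑-const s r) ⟨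
  ∑ {s} (λ _ → ∑ {r} (λ _ → 1))                ≡⟨ sum-cong-≗ {s} (λ i → sum-cong-≗ {r} (λ j → cong ⟦_⟧ (≡.sym (dec-true (Forward? _ _) (edge i j))))) ⟩
  ∑ {s} (λ i → ∑ {r} (λ j → F (i ↑ˡ r) (s ↑ʳ j)))  ≤⟨ ∑-mono {s} (λ i → ≤-trans (m≤n+m _ (∑ {s} (λ j → F (i ↑ˡ r) (j ↑ˡ r)))) (≤-reflexive (≡.sym (∑-++ s (F (i ↑ˡ r)))))) ⟩
  ∑ {s} (λ i → ∑ (F (i ↑ˡ r)))                 ≤⟨ m≤m+n _ _ ⟩
  ∑ {s} (λ i → ∑ (F (i ↑ˡ r))) + ∑ {r} (λ i → ∑ (F (s ↑ʳ i))) ≡⟨ ∑-++ s (λ i → ∑ (F i)) ⟨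
  ∑ (λ i → ∑ (F i))                            ≡⟨ edges-graph (s + r) ⟨
  edges (graph (s + r))                        ∎
  where
  open ≤-Reasoning
  open Hub s
  F : Fin (s + r) → Fin (s + r) → ℕ
  F i j = ⟦ does (Forward? (toℕ i) (toℕ j)) ⟧
  edge : (i : Fin s) (j : Fin r) → toℕ (i ↑ˡ r) < toℕ (s ↑ʳ j) × toℕ (i ↑ˡ r) < s
  edge i j rewrite toℕ-↑ˡ i r | toℕ-↑ʳ s j = ≤-trans (toℕ<n i) (m≤m+n s _) , toℕ<n i

-- Cliques strung on a path.

-- The binomial coefficient C(k, 2), the number of edges of a clique on `k` vertices.
triangular : ℕ → ℕ
triangular zero    = 0
triangular (suc k) = k + triangular k

∑-< : ∀ k → ∑ {k} (λ i → ∑ {k} (λ j → ⟦ toℕ i <ᵇ toℕ j ⟧)) ≡ triangular k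
∑-< zero    = refl
∑-< (suc k) = cong₂ _+_ (trans (∑-const k 1) (*-identityʳ k)) (∑-< k)

-- A Hamiltonian path 0, 1, …, n−1 cut into blocks of length a + c; the first a vertices of each block form a clique.
module Beads (a c : ℕ) .{{_ : NonZero (a + c)}} where

  b : ℕ
  b = a + c

  Near : ℕ → ℕ → Set
  Near i j = suc i ≡ j ⊎ (i / b ≡ j / b × i % b < a × j % b < a)

  Near? : ∀ i j → Dec (Near i j)
  Near? i j = (suc i ≟ j) ⊎-dec ((i / b ≟ j / b) ×-dec (i % b <? a) ×-dec (j % b <? a))

  open Forward Near? public

  beads-connected : ∀ n → Connected (graph n)
  beads-connected n = descending⇒connected (graph n) down
    where
    down : ∀ j → 0 < toℕ j → ∃ λ i → toℕ i < toℕ j × adj (graph n) j i ≡ true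
    down (suc j) _ = inject₁ j , lt , adj-sym (graph n) {inject₁ j} {suc j}
      (⇒adj {i = inject₁ j} {suc j} lt (inj₁ (cong suc (toℕ-inject₁ j))))
      where
      lt : toℕ (inject₁ j) < suc (toℕ j)
      lt = s≤s (≤-reflexive (toℕ-inject₁ j))

  module _ (q : ℕ) {r : ℕ} (r<b : r < b) where

    position-% : (q * b + r) % b ≡ r
    position-% = trans (cong (_% b) (+-comm (q * b) r)) (trans ([m+kn]%n≡m%n r q b) (m<n⇒m%n≡m r<b))

    position-/ : (q * b + r) / b ≡ q
    position-/ = *-cancelʳ-≡ _ q b (+-cancelʳ-≡ r _ _ (≡.sym (begin
      q * b + r                                       ≡⟨ m≡m%n+[m/n]*n (q * b + r) b ⟩
      (q * b + r) % b + (q * b + r) / b * b           ≡⟨ +-comm _ ((q * b + r) / b * b) ⟩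
      (q * b + r) / b * b + (q * b + r) % b           ≡⟨ cong ((q * b + r) / b * b +_) position-% ⟩
      (q * b + r) / b * b + r                         ∎)))
      where open ≡-Reasoning

  -- Only edges inside the `t` cliques are counted. The range of the second endpoint, then that of
  -- the first, is widened from the clique to the whole graph.
  beads-edges : ∀ t → t * triangular a ≤ edges (graph (t * b))
  beads-edges t = begin
    t * triangular a
      ≡⟨ ∑-const t (triangular a) ⟨
    ∑ {t} (λ _ → triangular a)
      ≡⟨ sum-cong-≗ {t} (λ q → ≡.sym (∑-< a)) ⟩
    ∑ {t} (λ q → ∑ {a} (λ i → ∑ {a} (λ j → ⟦ toℕ i <ᵇ toℕ j ⟧)))
      ≤⟨ ∑-mono {t} (λ q → ∑-mono {a} (λ i → ∑-mono {a} (λ j → clique q i j))) ⟩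
    ∑ {t} (λ q → ∑ {a} (λ i → ∑ {a} (λ j → F (at q i) (at q j))))
      ≤⟨ ∑-mono {t} (λ q → ∑-mono {a} (λ i → ≤-trans (initial (λ r → F (at q i) (combine q r)))
           (≤-trans (term≤∑ {t} (λ q′ → ∑ (λ r → F (at q i) (combine q′ r))) q) (≤-reflexive (≡.sym (∑-combine t (F (at q i)))))))) ⟩
    ∑ {t} (λ q → ∑ {a} (λ i → ∑ (F (at q i))))
      ≤⟨ ∑-mono {t} (λ q → initial (λ r → ∑ (F (combine q r)))) ⟩
    ∑ {t} (λ q → ∑ {b} (λ r → ∑ (F (combine q r))))
      ≡⟨ ∑-combine t (λ x → ∑ (F x)) ⟨
    ∑ (λ x → ∑ (F x))
      ≡⟨ edges-graph (t * b) ⟨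
    edges (graph (t * b)) ∎
    where
    open ≤-Reasoning
    F : Fin (t * b) → Fin (t * b) → ℕ
    F x y = ⟦ does (Forward? (toℕ x) (toℕ y)) ⟧
    at : Fin t → Fin a → Fin (t * b)
    at q i = combine {t} {b} q (i ↑ˡ c)
    initial : (f : Fin b → ℕ) → ∑ {a} (λ i → f (i ↑ˡ c)) ≤ ∑ f
    initial f = ≤-trans (m≤m+n _ _) (≤-reflexive (≡.sym (∑-++ a f)))
    toℕ-at : ∀ q i → toℕ (at q i) ≡ toℕ q * b + toℕ i
    toℕ-at q i = trans (toℕ-combine q (i ↑ˡ c)) (cong₂ _+_ (*-comm b (toℕ q)) (toℕ-↑ˡ i c))
    i<b : (i : Fin a) → toℕ i < b
    i<b i = ≤-trans (toℕ<n i) (m≤m+n a c)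
    clique : ∀ q i j → ⟦ toℕ i <ᵇ toℕ j ⟧ ≤ F (at q i) (at q j)
    clique q i j with toℕ i <? toℕ j
    ... | no  i≮j rewrite dec-false (toℕ i <? toℕ j) i≮j = z≤n
    ... | yes i<j = ≤-trans (⟦⟧≤1 (toℕ i <ᵇ toℕ j)) (≤-reflexive (cong ⟦_⟧ (≡.sym (dec-true (Forward? _ _) near))))
      where
      near : toℕ (at q i) < toℕ (at q j) × Near (toℕ (at q i)) (toℕ (at q j))
      near rewrite toℕ-at q i | toℕ-at q j =
        +-monoʳ-< (toℕ q * b) i<j ,
        inj₂ (trans (position-/ (toℕ q) (i<b i)) (≡.sym (position-/ (toℕ q) (i<b j))) ,
              subst (_< a) (≡.sym (position-% (toℕ q) (i<b i))) (toℕ<n i) ,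
              subst (_< a) (≡.sym (position-% (toℕ q) (i<b j))) (toℕ<n j))

  OnPath : ℕ → Set
  OnPath p = a ≤ p % b

  same-block-% : ∀ {p y} → p ≤ y → p / b ≡ y / b → p % b ≤ y % b
  same-block-% {p} {y} p≤y same = +-cancelʳ-≤ (y / b * b) _ _ (begin
    p % b + y / b * b   ≡⟨ cong (λ q → p % b + q * b) same ⟨
    p % b + p / b * b   ≡⟨ m≡m%n+[m/n]*n p b ⟨
    p                   ≤⟨ p≤y ⟩
    y                   ≡⟨ m≡m%n+[m/n]*n y b ⟩
    y % b + y / b * b   ∎)
    where open ≤-Reasoning

  -- A clique edge jumping over the gap after `p` would have both ends in the block of `p`, where
  -- everything beyond `p` has residue at least `a`. Only the path edge from `p` remains.
  bridge : {x y : Fin n} (p : ℕ) → OnPath p → adj (graph n) x y ≡ true → toℕ x ≤ p → p < toℕ y →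
           toℕ x ≡ p × toℕ y ≡ suc p
  bridge {x = x} {y} p on xy x≤p p<y with adj⇒ {i = x} {y} xy
  ... | inj₂ (y<x , _) = contradiction (<-trans (≤-<-trans x≤p p<y) y<x) (n≮n _)
  ... | inj₁ (_ , inj₁ step≡) = x≡p , trans (≡.sym step≡) (cong suc x≡p)
    where
    x≡p : toℕ x ≡ p
    x≡p = ≤-antisym x≤p (≤-pred (subst (p <_) (≡.sym step≡) p<y))
  ... | inj₁ (_ , inj₂ (same , _ , y<a)) = contradiction (≤-<-trans (≤-trans on (same-block-% (<⇒≤ p<y) p-block)) y<a) (n≮n a)
    where
    p-block : p / b ≡ toℕ y / b
    p-block = ≤-antisym (/-monoˡ-≤ b (<⇒≤ p<y)) (≤-trans (≤-reflexive (≡.sym same)) (/-monoˡ-≤ b x≤p))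

  -- `f` gives positions in the beads and `g` ranks in the hub graph. The ranks below `s` number a
  -- vertex cover of `T`, and playing it against the positions bounds `m`.
  module NoCopy {m n n′ s : ℕ} (T : Graph m) (connected : Connected T)
                (cover : Contains T (Hub.graph s n′)) (copy : Contains T (graph n)) where

    f : Fin m → Fin n
    f = proj₁ copy

    g : Fin m → Fin n′
    g = proj₁ cover

    position-injective : ∀ {u v} → toℕ (f u) ≡ toℕ (f v) → u ≡ v
    position-injective e = proj₁ (proj₂ copy) (toℕ-injective e)

    rank-injective : ∀ {u v} → toℕ (g u) ≡ toℕ (g v) → u ≡ v
    rank-injective e = proj₁ (proj₂ cover) (toℕ-injective e)

    Covered : Fin m → Set
    Covered u = toℕ (g u) < s

    edge-covered : ∀ {u v} → adj T u v ≡ true → Covered u ⊎ Covered v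
    edge-covered {u} {v} uv with Hub.adj⇒ s {i = g u} {g v} (proj₂ (proj₂ cover) u v uv)
    ... | inj₁ (_ , u<s) = inj₁ u<s
    ... | inj₂ (_ , v<s) = inj₂ v<s

    -- `T` is connected, so a copy with vertices on both sides of the gap after `p` uses an edge
    -- across it, and `bridge` identifies that edge.
    crossing : ∀ {u w} p → OnPath p → toℕ (f u) ≤ p → p < toℕ (f w) →
               ∃₂ λ x y → adj T x y ≡ true × toℕ (f x) ≡ p × toℕ (f y) ≡ suc p
    crossing {u} {w} p on u≤p p<w
      with x , y , xy , x≤p , y≰p ← walk-exit (λ z → does (toℕ (f z) ≤? p)) (connected u w)
             (dec-true (toℕ (f u) ≤? p) u≤p) (dec-false (toℕ (f w) ≤? p) (<⇒≱ p<w)) =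
      x , y , xy , bridge {x = f x} {f y} p on (proj₂ (proj₂ copy) x y xy)
                     (witness (toℕ (f x) ≤? p) x≤p) (≰⇒> (λ le → case trans (≡.sym y≰p) (dec-true (toℕ (f y) ≤? p) le) of λ ()))

    -- One slot per covered vertex, one per predecessor of a covered vertex and one for the end of
    -- the copy: 2s + 1 in all.
    Slot : Set
    Slot = Fin s ⊎ (Fin s ⊎ Fin 1)

    -- Away from the cliques, a copy of T follows the path, so an uncovered vertex which is not
    -- the last one of the copy has a covered successor; that successor determines it.
    data Assigned (u : Fin m) : Slot → Set where
      covered : ∀ {k} → toℕ (g u) ≡ toℕ k → Assigned u (inj₁ k)
      next    : ∀ {k} w → toℕ (f w) ≡ suc (toℕ (f u)) → toℕ (g w) ≡ toℕ k → Assigned u (inj₂ (inj₁ k))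
      last    : (∀ w → toℕ (f w) ≤ toℕ (f u)) → Assigned u (inj₂ (inj₂ zero))

    assign : ∀ u → OnPath (toℕ (f u)) → ∃ (Assigned u)
    assign u on with toℕ (g u) <? s
    ... | yes u<s = inj₁ (fromℕ< u<s) , covered (≡.sym (toℕ-fromℕ< u<s))
    ... | no  u≮s with any? (λ w → toℕ (f u) <? toℕ (f w))
    ... | no  none = inj₂ (inj₂ zero) , last (λ w → ≮⇒≥ (λ lt → none (w , lt)))
    -- The gap just after `u` is crossed only by the edge from `u` to its successor, so if `u` is
    -- uncovered the successor is covered.
    ... | yes (w , lt) with x , y , xy , x≡ , y≡ ← crossing _ on ≤-refl lt with refl ← position-injective {x} {u} x≡
      with edge-covered xy
    ... | inj₁ u<s = contradiction u<s u≮s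
    ... | inj₂ y<s = inj₂ (inj₁ (fromℕ< y<s)) , next y y≡ (≡.sym (toℕ-fromℕ< y<s))

    assigned-injective : ∀ {u v k} → Assigned u k → Assigned v k → u ≡ v
    assigned-injective (covered e)   (covered e′)    = rank-injective (trans e (≡.sym e′))
    assigned-injective (next w p e)  (next w′ p′ e′) with refl ← rank-injective {w} {w′} (trans e (≡.sym e′)) =
      position-injective (suc-injective (trans (≡.sym p) p′))
    assigned-injective {u} {v} (last h) (last h′) = position-injective (≤-antisym (h′ u) (h v))

    encode : Slot → Fin (s + (s + 1))
    encode = join s (s + 1) ∘ Sum.map₂ (join s 1)

    encode-injective : ∀ {x y} → encode x ≡ encode y → x ≡ y
    encode-injective {x} {y} e = map₂-injective x y (join-injective s (s + 1) e)
      where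
      join-injective : ∀ k l {x y : Fin k ⊎ Fin l} → join k l x ≡ join k l y → x ≡ y
      join-injective k l {x} {y} e = trans (≡.sym (splitAt-join k l x)) (trans (cong (splitAt k) e) (splitAt-join k l y))
      map₂-injective : ∀ x y → Sum.map₂ (join s 1) x ≡ Sum.map₂ (join s 1) y → x ≡ y
      map₂-injective (inj₁ _) (inj₁ _) refl = refl
      map₂-injective (inj₂ x) (inj₂ y) e    = cong inj₂ (join-injective s 1 (inj₂-injective e))

    path-vertices-≤ : {h : Fin k → Fin m} → Injective _≡_ _≡_ h → (∀ i → OnPath (toℕ (f (h i)))) → k ≤ s + (s + 1)
    path-vertices-≤ {h = h} inj on = injective⇒≤ {f = λ i → encode (proj₁ (assign (h i) (on i)))} λ {i} {j} e →
      inj (assigned-injective (subst (Assigned (h i)) (encode-injective e) (proj₂ (assign (h i) (on i)))) (proj₂ (assign (h j) (on j))))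

    module _ (long : s + (s + 1) < c) where

      -- Clique vertices in two blocks would force the copy to occupy all `c` path positions of the
      -- lower block, more than the 2s + 1 that `path-vertices-≤` allows.
      one-clique : ∀ u v → ¬ OnPath (toℕ (f u)) → ¬ OnPath (toℕ (f v)) → ¬ (toℕ (f u) / b < toℕ (f v) / b)
      one-clique u v u-clique v-clique lt = contradiction (path-vertices-≤ {h = proj₁ ∘ at} at-injective at-path) (<⇒≱ long)
        where
        q : ℕ
        q = toℕ (f u) / b
        pos : Fin c → ℕ
        pos i = q * b + (a + toℕ i)
        r<b : ∀ i → a + toℕ i < b
        r<b i = +-monoʳ-< a (toℕ<n i)
        pos-path : ∀ i → OnPath (pos i)
        pos-path i = subst (a ≤_) (≡.sym (position-% q (r<b i))) (m≤m+n a _)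
        above : ∀ i → toℕ (f u) ≤ pos i
        above i = begin
          toℕ (f u)                   ≡⟨ m≡m%n+[m/n]*n (toℕ (f u)) b ⟩
          toℕ (f u) % b + q * b       ≡⟨ +-comm _ (q * b) ⟩
          q * b + toℕ (f u) % b       ≤⟨ +-monoʳ-≤ (q * b) (≤-trans (<⇒≤ (≰⇒> u-clique)) (m≤m+n a _)) ⟩
          pos i                       ∎
          where open ≤-Reasoning
        below : ∀ i → pos i < toℕ (f v)
        below i = begin-strict
          q * b + (a + toℕ i)         <⟨ +-monoʳ-< (q * b) (r<b i) ⟩
          q * b + b                   ≡⟨ +-comm (q * b) b ⟩
          suc q * b                   ≤⟨ *-monoˡ-≤ b lt ⟩
          toℕ (f v) / b * b           ≤⟨ m/n*n≤m (toℕ (f v)) b ⟩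
          toℕ (f v)                   ∎
          where open ≤-Reasoning
        at : ∀ i → ∃ λ x → toℕ (f x) ≡ pos i
        at i = let x , _ , _ , e , _ = crossing {u} {v} (pos i) (pos-path i) (above i) (below i) in x , e
        at-path : ∀ i → OnPath (toℕ (f (proj₁ (at i))))
        at-path i = subst OnPath (≡.sym (proj₂ (at i))) (pos-path i)
        at-injective : Injective _≡_ _≡_ (proj₁ ∘ at)
        at-injective {i} {j} e = toℕ-injective (+-cancelˡ-≡ a _ _ (+-cancelˡ-≡ (q * b) _ _
          (trans (≡.sym (proj₂ (at i))) (trans (cong (toℕ ∘ f) e) (proj₂ (at j))))))

      -- Vertices on the path are coded by their slots, clique vertices by their residues below `a`.
      -- Residues suffice because `one-clique` puts all clique vertices in one block.
      copy-size : m ≤ a + (s + (s + 1))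
      copy-size = injective⇒≤ {f = code} λ {u} {v} e → separated u v (on? u) (on? v) e
        where
        on? : ∀ u → Dec (OnPath (toℕ (f u)))
        on? u = a ≤? toℕ (f u) % b
        slot : ∀ u → Dec (OnPath (toℕ (f u))) → Fin a ⊎ Fin (s + (s + 1))
        slot u (yes on) = inj₂ (encode (proj₁ (assign u on)))
        slot u (no off) = inj₁ (fromℕ< (≰⇒> off))
        code : Fin m → Fin (a + (s + (s + 1)))
        code u = join a _ (slot u (on? u))
        separated : ∀ u v du dv → join a (s + (s + 1)) (slot u du) ≡ join a (s + (s + 1)) (slot v dv) → u ≡ v
        separated u v du dv e = distinct du dv (trans (≡.sym (splitAt-join a _ (slot u du))) (trans (cong (splitAt a) e) (splitAt-join a _ (slot v dv))))
          where
          distinct : ∀ du dv → slot u du ≡ slot v dv → u ≡ v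
          distinct (yes ou) (yes ov) e = assigned-injective
            (subst (Assigned u) (encode-injective (inj₂-injective e)) (proj₂ (assign u ou))) (proj₂ (assign v ov))
          distinct (no u-off) (no v-off) e = position-injective (begin
            toℕ (f u)                               ≡⟨ m≡m%n+[m/n]*n (toℕ (f u)) b ⟩
            toℕ (f u) % b + toℕ (f u) / b * b       ≡⟨ cong₂ (λ r q → r + q * b) same-% same-/ ⟩
            toℕ (f v) % b + toℕ (f v) / b * b       ≡⟨ m≡m%n+[m/n]*n (toℕ (f v)) b ⟨
            toℕ (f v)                               ∎)
            where
            open ≡-Reasoning
            same-% : toℕ (f u) % b ≡ toℕ (f v) % b
            same-% = trans (≡.sym (toℕ-fromℕ< _)) (trans (cong toℕ (inj₁-injective e)) (toℕ-fromℕ< _))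
            same-/ : toℕ (f u) / b ≡ toℕ (f v) / b
            same-/ = ≤-antisym (≮⇒≥ (one-clique v u v-off u-off)) (≮⇒≥ (one-clique u v u-off v-off))

-- Densities and the lower bound.

6*triangular : ∀ k → 6 * triangular (suc k) ≡ 3 * (suc k * k)
6*triangular zero    = refl
6*triangular (suc k) = trans (*-distribˡ-+ 6 (suc k) (triangular (suc k))) (trans (cong (6 * suc k +_) (6*triangular k)) (ring k))
  where
  ring : ∀ k → 6 * suc k + 3 * (suc k * k) ≡ 3 * (suc (suc k) * suc k)
  ring = solve-∀

-- With M = `36 + (r + τ * 6)`, block length M + 2 and clique size a = `22 + r + τ * 4`, this says
-- that the ratio 2C(a, 2)/(M(M + 2)) of one block is at least 1/3. Starting at M = 30, a = 18 would
-- demand 960 ≤ 918; hence the threshold 38 in `gammaLower`.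
beads-triangular : ∀ τ r → (36 + (r + τ * 6)) * (38 + (r + τ * 6)) ≤ 6 * triangular (22 + r + τ * 4)
beads-triangular τ r = begin
  (36 + (r + τ * 6)) * (38 + (r + τ * 6))              ≤⟨ m≤m+n _ (12 * τ * τ + 12 * τ * r + 72 * τ + 2 * r * r + 55 * r + 18) ⟩
  (36 + (r + τ * 6)) * (38 + (r + τ * 6)) + (12 * τ * τ + 12 * τ * r + 72 * τ + 2 * r * r + 55 * r + 18)
                                                       ≡⟨ excess τ r ⟩
  3 * ((22 + r + τ * 4) * (21 + r + τ * 4))            ≡⟨ 6*triangular (21 + r + τ * 4) ⟨
  6 * triangular (22 + r + τ * 4)                      ∎
  where
  open ≤-Reasoning
  excess : ∀ τ r → (36 + (r + τ * 6)) * (38 + (r + τ * 6)) + (12 * τ * τ + 12 * τ * r + 72 * τ + 2 * r * r + 55 * r + 18)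
                 ≡ 3 * ((22 + r + τ * 4) * (21 + r + τ * 4))
  excess = solve-∀

LowerWitness : ∀ {m} → ℕ → ℕ → Graph m → Set
LowerWitness {m} q N T = ∃[ n ] (N ≤ n × Σ (Graph n) λ G →
  Connected G × ¬ Contains T G × (q * (m ∸ 2) * n < 6 * q * edges G + 3 * (m ∸ 2) * n))

-- The `s * R` edges pay for the `R` vertices outside the hub, as `suc M ≤ 6 * s`. The hub's own
-- share `q * suc M * s` is charged to the error term, which is why `R` is at least `q * s`.
hub-dense : ∀ q M s N → suc M ≤ 6 * s → 0 < s → let R = q * s + N in
  q * suc M * (s + R) < 6 * q * edges (Hub.graph s (s + R)) + 3 * suc M * (s + R)
hub-dense q M s@(suc _) N M<6s _ = begin-strict
  q * suc M * (s + R)                              ≡⟨ *-distribˡ-+ (q * suc M) s R ⟩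
  q * suc M * s + q * suc M * R                    ≤⟨ +-mono-≤ small large ⟩
  suc M * R + 6 * q * (s * R)                      <⟨ m<m+n _ {3 * suc M * s + 2 * suc M * R} z<s ⟩
  suc M * R + 6 * q * (s * R) + (3 * suc M * s + 2 * suc M * R) ≡⟨ collect q (suc M) s R ⟩
  6 * q * (s * R) + 3 * suc M * (s + R)            ≤⟨ +-monoˡ-≤ (3 * suc M * (s + R)) (*-monoʳ-≤ (6 * q) (hub-edges s R)) ⟩
  6 * q * edges (Hub.graph s (s + R)) + 3 * suc M * (s + R) ∎
  where
  open ≤-Reasoning
  R : ℕ
  R = q * s + N
  collect : ∀ q M s R → M * R + 6 * q * (s * R) + (3 * M * s + 2 * M * R) ≡ 6 * q * (s * R) + 3 * M * (s + R)
  collect = solve-∀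
  small : q * suc M * s ≤ suc M * R
  small = ≤-trans (≤-reflexive (swap q (suc M) s)) (*-monoʳ-≤ (suc M) (m≤m+n (q * s) N))
    where
    swap : ∀ q M s → q * M * s ≡ M * (q * s)
    swap = solve-∀
  large : q * suc M * R ≤ 6 * q * (s * R)
  large = ≤-trans (*-monoˡ-≤ R (*-monoʳ-≤ q M<6s)) (≤-reflexive (swap q s R))
    where
    swap : ∀ q s R → q * (6 * s) * R ≡ 6 * q * (s * R)
    swap = solve-∀

-- By `dense` each block alone reaches the ratio 1/3, so taking whole blocks gives the bound; the
-- error term supplies strictness.
beads-dense : ∀ q M a c .{{_ : NonZero (a + c)}} N → suc M * (a + c) ≤ 6 * triangular a → let n = suc N * (a + c) in
  q * suc M * n < 6 * q * edges (Beads.graph a c n) + 3 * suc M * n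
beads-dense q M a c N dense = begin-strict
  q * suc M * (suc N * b)                                  ≡⟨ swap q (suc M) (suc N) b ⟩
  q * suc N * (suc M * b)                                  ≤⟨ *-monoʳ-≤ (q * suc N) dense ⟩
  q * suc N * (6 * triangular a)                           ≡⟨ swap′ q (suc N) (triangular a) ⟩
  6 * q * (suc N * triangular a)                           ≤⟨ *-monoʳ-≤ (6 * q) (Beads.beads-edges a c (suc N)) ⟩
  6 * q * edges (Beads.graph a c (suc N * b))              <⟨ m<m+n _ (*-mono-< {0} {3 * suc M} z<s (>-nonZero⁻¹ (suc N * b) {{m*n≢0 (suc N) b}})) ⟩
  6 * q * edges (Beads.graph a c (suc N * b)) + 3 * suc M * (suc N * b) ∎
  where
  open ≤-Reasoning
  b : ℕ
  b = a + c
  swap : ∀ q M t b → q * M * (t * b) ≡ q * t * (M * b)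
  swap = solve-∀
  swap′ : ∀ q t x → q * t * (6 * x) ≡ 6 * q * (t * x)
  swap′ = solve-∀

-- `contains?` chooses between the two graphs. Here `suc M` is |T| - 2 and the block length is |T|.
-- As c = 2s + 2 exceeds 2s + 1 by one, a copy of `T` in the beads would have at most a + 2s + 1 =
-- |T| - 1 vertices.
lower-witness : ∀ q N M s a .{{_ : NonZero (a + (2 + s + s))}} (T : Graph (3 + M)) → Connected T → 0 < s →
  suc M ≤ 6 * s → a + (2 + s + s) ≡ 3 + M → suc M * (3 + M) ≤ 6 * triangular a → LowerWitness q N T
lower-witness q N M s a T conn s>0 M<6s b≡m dense = choose (contains? T (Hub.graph s (s + R)))
  where
  R c : ℕ
  R = q * s + N
  c = 2 + s + s
  long : s + (s + 1) < c
  long = ≤-reflexive (ring s)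
    where
    ring : ∀ s → suc (s + (s + 1)) ≡ 2 + s + s
    ring = solve-∀
  choose : Dec (Contains T (Hub.graph s (s + R))) → LowerWitness q N T
  choose (no free) = s + R , ≤-trans (m≤n+m N (q * s)) (m≤n+m R s) , Hub.graph s (s + R) , hub-connected s (s + R) s>0 ,
    free , hub-dense q M s N M<6s s>0
  choose (yes cover) = suc N * (a + c) , ≤-trans (n≤1+n N) (m≤m*n (suc N) (a + c)) ,
    Beads.graph a c (suc N * (a + c)) , Beads.beads-connected a c (suc N * (a + c)) ,
    (λ copy → contradiction (Beads.NoCopy.copy-size a c {s = s} T conn cover copy long) (<⇒≱ small)) ,
    beads-dense q M a c N (subst (λ b → suc M * b ≤ 6 * triangular a) (≡.sym b≡m) dense)
    where
    small : a + (s + (s + 1)) < 3 + M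
    small = ≤-trans (≤-reflexive (≡.sym (+-suc a _))) (≤-trans (+-monoʳ-≤ a long) (≤-reflexive b≡m))

-- With M = 36 + r + 6τ = |T| − 2 and r ≤ 5, the bound on the cover is s = τ + 7 = ⌊M/6⌋ + 1.
gammaLower : GammaLower
gammaLower q _ = 38 , λ m 38≤m _ T tree N →
  let o , 38+o≡m = m≤n⇒∃[o]m+o≡n 38≤m
      m≡ = trans (≡.sym 38+o≡m) (cong (38 +_) (m≡m%n+[m/n]*n o 6))
  in subst (λ m → (T : Graph m) → Connected T → LowerWitness q N T) (≡.sym m≡)
       (split N (o / 6) (o % 6) (m%n<n o 6)) T (proj₁ tree)
  where
  split : ∀ N τ r → r < 6 → (T : Graph (38 + (r + τ * 6))) → Connected T → LowerWitness q N T
  split N τ r r<6 T conn = lower-witness q N (35 + (r + τ * 6)) (7 + τ) (22 + r + τ * 4) T conn z<s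
    (≤-trans (+-monoʳ-≤ 36 (+-monoˡ-≤ (τ * 6) (<⇒≤ r<6))) (≤-reflexive (expand τ)))
    (ring τ r) (beads-triangular τ r)
    where
    expand : ∀ τ → 36 + (6 + τ * 6) ≡ 6 * (7 + τ)
    expand = solve-∀
    ring : ∀ τ r → 22 + r + τ * 4 + (2 + (7 + τ) + (7 + τ)) ≡ 38 + (r + τ * 6)
    ring = solve-∀

theorem1p5 : GammaLower × GammaUpper
theorem1p5 = gammaLower , gammaUpper
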